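{- Let $B_1$ and $B_2$ be two bouquets. If $B_1$ and $B_2$ have the same signed intersection graph (i.e. $SI(B_1)$ and $SI(B_2)$ are isomorphic as vertex-signed graphs), then their partial-dual Euler genus polynomials coincide: ${}^{\partial}\varepsilon_{B_1}(z)={}^{\partial}\varepsilon_{B_2}(z)$.
   Context: Ribbon graphs are finite, possibly non-orientable. For a ribbon graph $G$, let $v(G),e(G),f(G)$ be its numbers of vertices, edges and boundary components. For connected $G$ the Euler genus $\varepsilon(G)$ is defined by $2-\varepsilon(G)=v(G)-e(G)+f(G)$. For $A\subseteq E(G)$ the partial dual $G^{A}$ is obtained as follows: take the spanning ribbon subgraph $(V(G),A)$, glue a disc to $G$ along each boundary component of this subgraph (these discs are the vertex-discs of $G^A$), and remove the interiors of all vertex-discs of $G$; the edge-ribbons are kept as the edges of $G^A$. The partial-dual Euler genus polynomial of $G$ is ${}^{\partial}\varepsilon_{G}(z)=\sum_{A\subseteq E(G)}z^{\varepsilon(G^{A})}$. A bouquet is a ribbon graph with exactly one vertex. A loop $e$ at the vertex-disc $v$ is twisted if $e\cup v$ is homeomorphic to a Möbius band, and untwisted otherwise. The intersection graph $I(B)$ of a bouquet $B$ is the graph with vertex set $E(B)$ in which distinct $e$ and $f$ are adjacent if and only if their ends are met in the cyclic order $e\cdots f\cdots e\cdots f\cdots$ when travelling around the boundary of the unique vertex of $B$. The signed intersection graph $SI(B)$ is $I(B)$ together with a sign at each vertex: $+$ if the corresponding edge of $B$ is an untwisted loop, $-$ if it is a twisted loop. -}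

module Defs where

open import Algebra.Definitions using (Involutive)
open import Data.Bool.Base using (Bool; true; false; not; if_then_else_)
import Data.Bool.Properties as Bool
open import Data.Fin.Base using (Fin)
import Data.Fin.Properties as Fin
open import Data.Fin.Subset using (Subset; inside; outside)
open import Data.Integer.Base as ℤ using (ℤ; +_)
import Data.Integer.Properties as ℤ
open import Data.List.Base using (List; []; _∷_; [_]; _++_; map; filter; length; allFin; cartesianProduct; deduplicate)
open import Data.List.Membership.Propositional using (_∈_)
open import Data.List.Membership.Propositional.Properties using (∈-map⁺; ∈-map⁻; ∈-++⁺ˡ; ∈-++⁺ʳ; ∈-++⁻; ∈-allFin; ∈-cartesianProduct⁺)
open import Data.List.Relation.Unary.Any using (here; there)
open import Data.Nat.Base using (ℕ; _+_; _*_; _<_)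
open import Data.Nat.GeneralisedArithmetic using (iterate)
open import Data.Product.Base using (Σ; _×_; _,_; proj₁; proj₂; ∃-syntax)
open import Data.Product.Properties using (≡-dec)
open import Data.Sum.Base using (_⊎_; inj₁; inj₂)
import Data.Vec.Base as Vec
open import Function.Base using (_∘_)
open import Function.Bundles using (_↔_; _⇔_; Inverse)
open import Relation.Binary.Construct.Closure.Equivalence using (EqClosure; isEquivalence; fold; return)
import Relation.Binary.Construct.Closure.Equivalence as EqC
import Relation.Binary.Construct.On as On
open import Relation.Binary.Core using (Rel)
open import Relation.Binary.Definitions using (Decidable; DecidableEquality)
open import Relation.Binary.PropositionalEquality using (_≡_; _≢_; refl; sym; trans; cong)
import Relation.Binary.PropositionalEquality.Properties as ≡
open import Relation.Binary.Structures using (IsEquivalence)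
open import Relation.Nullary.Decidable using (yes; no; map′)
open import Relation.Nullary.Negation using (contradiction)

-- The equivalence relation generated by a finite list of pairs is decidable:
-- process the pairs one at a time, keeping a label for each element.
module _ {A : Set} (_≟_ : DecidableEquality A) where

  Linked : List (A × A) → Rel A _
  Linked ps = EqClosure (λ x y → (x , y) ∈ ps)

  private
    relabel : A → A → A → A
    relabel a b c with c ≟ a
    ... | yes _ = b
    ... | no  _ = c

    label : List (A × A) → A → A
    label []             = λ x → x
    label ((u , v) ∷ ps) = relabel (label ps u) (label ps v) ∘ label ps

    relabel-source : ∀ a b → relabel a b a ≡ b
    relabel-source a b with a ≟ a
    ... | yes _   = refl
    ... | no  a≢a = contradiction refl a≢a

    relabel-target : ∀ a b → relabel a b b ≡ b
    relabel-target a b with b ≟ a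
    ... | yes _ = refl
    ... | no  _ = refl

    label-step : ∀ ps {x y} → (x , y) ∈ ps → label ps x ≡ label ps y
    label-step ((u , v) ∷ ps) (here refl) =
      trans (relabel-source (label ps u) (label ps v)) (sym (relabel-target (label ps u) (label ps v)))
    label-step ((u , v) ∷ ps) (there p)   =
      cong (relabel (label ps u) (label ps v)) (label-step ps p)

    label-complete : ∀ ps {x y} → Linked ps x y → label ps x ≡ label ps y
    label-complete ps = fold (On.isEquivalence (label ps) ≡.isEquivalence) (label-step ps)

    label-sound : ∀ ps {x y} → label ps x ≡ label ps y → Linked ps x y
    label-sound [] refl = IsEquivalence.refl (isEquivalence _)
    label-sound ((u , v) ∷ ps) {x} {y} eq with label ps x ≟ label ps u | label ps y ≟ label ps u
    ... | yes x∼u | yes y∼u = EqC.map there (label-sound ps (trans x∼u (sym y∼u)))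
    ... | yes x∼u | no  _   = E.trans (EqC.map there (label-sound ps x∼u))
                                (E.trans (return (here refl)) (EqC.map there (label-sound ps eq)))
      where module E = IsEquivalence (isEquivalence (λ x y → (x , y) ∈ (u , v) ∷ ps))
    ... | no  _   | yes y∼u = E.trans (EqC.map there (label-sound ps eq))
                                (E.trans (E.sym (return (here refl))) (EqC.map there (label-sound ps (sym y∼u))))
      where module E = IsEquivalence (isEquivalence (λ x y → (x , y) ∈ (u , v) ∷ ps))
    ... | no  _   | no  _   = EqC.map there (label-sound ps eq)

  linked? : ∀ ps → Decidable (Linked ps)
  linked? ps x y = map′ (label-sound ps) (label-complete ps) (label ps x ≟ label ps y)

-- The ribbon of edge e is the rectangle [0,1] × [0,1] with corners (e , i , s).
-- It is glued to the vertex-discs along its two ends {i} × [0,1]; its two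
-- remaining sides are [0,1] × {s}.
Corner : ℕ → Set
Corner n = Fin n × Bool × Bool

edge : ∀ {n} → Corner n → Fin n
edge = proj₁

_≟ᶜ_ : ∀ {n} → DecidableEquality (Corner n)
_≟ᶜ_ = ≡-dec Fin._≟_ (≡-dec Bool._≟_ Bool._≟_)

corners : ∀ n → List (Corner n)
corners n = cartesianProduct (allFin n) (cartesianProduct bools bools)
  where bools = false ∷ true ∷ []

acrossEnd : ∀ {n} → Corner n → Corner n
acrossEnd (e , i , s) = e , i , not s

alongSide : ∀ {n} → Corner n → Corner n
alongSide (e , i , s) = e , not i , s

module _ {n : ℕ} (f g : Corner n → Corner n) where

  Step : Rel (Corner n) _
  Step x y = f x ≡ y ⊎ g x ≡ y

  SameOrbit : Rel (Corner n) _
  SameOrbit = EqClosure Step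

  private
    graph : (Corner n → Corner n) → List (Corner n × Corner n)
    graph h = map (λ x → x , h x) (corners n)

    ∈-corners : ∀ x → x ∈ corners n
    ∈-corners (e , i , s) = ∈-cartesianProduct⁺ (∈-allFin e) (∈-cartesianProduct⁺ (∈-bools i) (∈-bools s))
      where
      ∈-bools : ∀ b → b ∈ false ∷ true ∷ []
      ∈-bools false = here refl
      ∈-bools true  = there (here refl)

    ∈-graph⁺ : ∀ h {x y} → h x ≡ y → (x , y) ∈ graph h
    ∈-graph⁺ h {x} refl = ∈-map⁺ (λ x → x , h x) (∈-corners x)

    ∈-graph⁻ : ∀ h {x y} → (x , y) ∈ graph h → h x ≡ y
    ∈-graph⁻ h p with ∈-map⁻ (λ x → x , h x) p
    ... | _ , _ , refl = refl

    step⁺ : ∀ {x y} → Step x y → (x , y) ∈ graph f ++ graph g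
    step⁺ (inj₁ p) = ∈-++⁺ˡ (∈-graph⁺ f p)
    step⁺ (inj₂ p) = ∈-++⁺ʳ (graph f) (∈-graph⁺ g p)

    step⁻ : ∀ {x y} → (x , y) ∈ graph f ++ graph g → Step x y
    step⁻ p with ∈-++⁻ (graph f) p
    ... | inj₁ q = inj₁ (∈-graph⁻ f q)
    ... | inj₂ q = inj₂ (∈-graph⁻ g q)

  sameOrbit? : Decidable SameOrbit
  sameOrbit? x y = map′ (EqC.map step⁻) (EqC.map step⁺) (linked? _≟ᶜ_ (graph f ++ graph g) x y)

  #orbits : ℕ
  #orbits = length (deduplicate sameOrbit? (corners n))

-- The corners cut the boundaries of the vertex-discs into ribbon ends and free
-- arcs, and `arc` exchanges the two endpoints of each free arc.  Conversely, a
-- fixed-point-free involution on the corners closes the ribbon ends up into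
-- circles, each bounding one vertex-disc.  Vertex-discs meeting no ribbon have
-- no corners and are counted separately.
record RibbonGraph : Set where
  field
    #edges         : ℕ
    #isolated      : ℕ
    arc            : Corner #edges → Corner #edges
    arc-involutive : Involutive _≡_ arc
    arc-fixedFree  : ∀ x → arc x ≢ x

open RibbonGraph public

#vertices : RibbonGraph → ℕ
#vertices G = #isolated G + #orbits (arc G) acrossEnd

#boundaries : RibbonGraph → ℕ
#boundaries G = #isolated G + #orbits (arc G) alongSide

-- This is the Euler genus for connected G only.  It is integer-valued so that
-- no truncated subtraction enters.
eulerGenus : RibbonGraph → ℤ
eulerGenus G = + 2 ℤ.- (+ #vertices G ℤ.- + #edges G ℤ.+ + #boundaries G)

-- The boundary of the spanning ribbon subgraph (V(G), A) runs along the free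
-- arcs, the sides of the ribbons in A, and the ends of the ribbons not in A.
-- These circles bound the vertex-discs of the partial dual, so the ribbons in A
-- are now attached along their former sides and those not in A along their ends
-- as before; the free arcs are unchanged.  Hence it suffices to exchange the two
-- coordinates of the corners of the ribbons in A.
module _ {n : ℕ} (A : Subset n) where

  exchange : Corner n → Corner n
  exchange (e , i , s) = if Vec.lookup A e then (e , s , i) else (e , i , s)

  exchange-involutive : Involutive _≡_ exchange
  exchange-involutive (e , i , s) with Vec.lookup A e in eq
  ... | true  rewrite eq = refl
  ... | false rewrite eq = refl

partialDual : (G : RibbonGraph) → Subset (#edges G) → RibbonGraph
partialDual G A = record
  { #edges         = #edges G
  ; #isolated      = #isolated G
  ; arc            = σ ∘ arc G ∘ σ
  ; arc-involutive = λ x → trans (cong (σ ∘ arc G) (σσ (arc G (σ x))))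
                             (trans (cong σ (arc-involutive G (σ x))) (σσ x))
  ; arc-fixedFree  = λ x p → arc-fixedFree G (σ x) (trans (sym (σσ (arc G (σ x)))) (cong σ p))
  }
  where
  σ  = exchange A
  σσ = exchange-involutive A

subsets : ∀ n → List (Subset n)
subsets ℕ.zero    = [ Vec.[] ]
subsets (ℕ.suc n) = map (outside Vec.∷_) (subsets n) ++ map (inside Vec.∷_) (subsets n)

-- A polynomial in z is given by its coefficients: `∂ε G k` is the coefficient of
-- z^k in the sum of z^ε(G^A) over all A ⊆ E(G).
∂ε : RibbonGraph → ℤ → ℕ
∂ε G k = length (filter (λ A → eulerGenus (partialDual G A) ℤ.≟ k) (subsets (#edges G)))

Bouquet : Set
Bouquet = Σ RibbonGraph (λ G → #vertices G ≡ 1)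

-- Travelling around a vertex-disc: from the corner at which a ribbon end is
-- entered, cross that end and follow the next free arc, thereby reaching the
-- corner at which the next ribbon end is entered.
next : (G : RibbonGraph) → Corner (#edges G) → Corner (#edges G)
next G x = arc G (acrossEnd x)

-- A full turn around the vertex of a bouquet G meets 2 e(G) ribbon ends.  The
-- starting corner x may be either end of a, in either direction of travel.
Interlaced : (B : Bouquet) → Rel (Fin (#edges (proj₁ B))) _
Interlaced (G , _) a b =
  ∃[ x ] ∃[ p ] ∃[ q ] ∃[ r ]
    p < q × q < r × r < 2 * #edges G ×
    edge x ≡ a × edge (at x p) ≡ b × edge (at x q) ≡ a × edge (at x r) ≡ b
  where at = iterate (next G)

-- One direction of travel around the vertex-disc crosses both ends of the ribbon
-- [0,1] × [0,1] towards the same side.  The disc is then a band joining the two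
-- ends with a half-twist, so ribbon and disc form a Möbius band; if the ends are
-- crossed towards opposite sides, they form an annulus.
Twisted : (B : Bouquet) → Fin (#edges (proj₁ B)) → Set
Twisted (G , _) a = ∃[ s ] ∃[ k ] iterate (next G) (a , false , s) k ≡ (a , true , s)

-- Graphs with a sign at each vertex; the vertices that are not negative are
-- positive.
record SignedGraph : Set₁ where
  field
    order    : ℕ
    Adjacent : Rel (Fin order) _
    Negative : Fin order → Set

record _≅_ (S T : SignedGraph) : Set where
  private
    module S = SignedGraph S
    module T = SignedGraph T
  field
    bijection : Fin S.order ↔ Fin T.order
  open Inverse bijection using (to)
  field
    adjacent : ∀ a b → S.Adjacent a b ⇔ T.Adjacent (to a) (to b)
    negative : ∀ a → S.Negative a ⇔ T.Negative (to a)

SI : Bouquet → SignedGraph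
SI B = record
  { order    = #edges (proj₁ B)
  ; Adjacent = λ a b → a ≢ b × Interlaced B a b
  ; Negative = Twisted B
  }

{-# OPTIONS --safe #-}
module Submission where

-- Let M be the symmetric matrix over 𝔽₂ with M_ab = 1 iff a and b are
-- interlaced (a ≠ b) and M_aa = 1 iff a is twisted; it is determined by SI(B).
-- The vertices and the boundary components of B^A are the orbits of the arcs
-- together with the sides of the ribbons in some set χ and the ends of the
-- others, where χ = A or χ = E ∖ A.  A Boolean function on the corners constant
-- on these orbits is given by its value at one corner and by its jumps x_e
-- across the ends of the ribbons e: the jump is the same at both ends, it
-- vanishes off χ, and closing up along the sides of χ means (Mx)_e = 0 for
-- e ∈ χ.  Hence 2^#orbits = 2 · #{x : supp x ⊆ χ, (Mx)|χ = 0} depends only on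
-- SI(B), and with it the Euler genus of every partial dual.

open import Defs
open import Algebra.Bundles using (CommutativeRing)
open import Algebra.Definitions using (Involutive)
import Algebra.Properties.CommutativeMonoid.Sum as Sum
open import Data.Bool.Base using (Bool; true; false; not; if_then_else_; _xor_; _∧_)
import Data.Bool.Properties as Bool
open import Data.Fin.Base as Fin using (Fin; zero; suc; toℕ; fromℕ<; combine; remQuot; finToFun; funToFin)
open import Data.Fin.Permutation using (↔⇒≡)
import Data.Fin.Properties as Fin
open import Data.Fin.Subset using (Subset; inside; outside)
open import Data.Integer.Base as ℤ using (+_)
import Data.Integer.Properties as ℤ
open import Data.List.Base using (List; []; _∷_; lookup; length; map; deduplicate)
open import Data.List.Membership.Propositional using (_∈_)
open import Data.List.Membership.Propositional.Properties using (∈-allFin; ∈-cartesianProduct⁺; ∈-filter⁺; ∈-filter⁻; ∈-lookup; ∈-map⁺; ∈-map⁻; ∈-++⁺ˡ; ∈-++⁺ʳ)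
import Data.List.Membership.Setoid as SetoidMembership
open import Data.List.Membership.Setoid.Properties using (index-injective)
open import Data.List.Relation.Unary.All as All using ([])
open import Data.List.Relation.Unary.AllPairs using ([]; _∷_)
open import Data.List.Relation.Unary.Any as Any using (here; there)
open import Data.List.Relation.Unary.Any.Properties using (lookup-index)
open import Data.List.Relation.Unary.Enumerates.Setoid.Properties using (deduplicate⁺)
import Data.List.Relation.Unary.Unique.DecSetoid.Properties as UniqueDec
import Data.List.Relation.Unary.Unique.Propositional as Propositional
import Data.List.Relation.Unary.Unique.Propositional.Properties as Unique
open import Data.List.Relation.Unary.Unique.Setoid using (Unique)
open import Data.Nat.Base using (ℕ; zero; suc; _+_; _*_; _∸_; _^_; _≤_; _<_; z≤n; z<s; s≤s⁻¹)
open import Data.Nat.GeneralisedArithmetic using (iterate)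
import Data.Nat.Properties as ℕ
open import Data.Product.Base using (_×_; _,_; proj₁; proj₂; ∃-syntax)
open import Data.Sum.Base using (_⊎_; inj₁; inj₂)
import Data.Vec.Base as Vec
import Data.Vec.Properties as Vec
open import Function.Base using (_∘_)
open import Function.Bundles using (_↔_; _⇔_; mk⇔; Inverse; Equivalence)
open import Function.Construct.Symmetry using (↔-sym; ⇔-sym)
open import Function.Properties.Equivalence using (⇔-isEquivalence)
open import Relation.Binary.Bundles using (Setoid; DecSetoid)
import Relation.Binary.Construct.Closure.Equivalence as EqC
open import Relation.Binary.Definitions using (tri<; tri≈; tri>)
open import Relation.Binary.PropositionalEquality
open import Relation.Nullary.Decidable using (yes; no; does; dec-true; dec-false; _×-dec_)
open import Relation.Nullary.Negation using (¬_; contradiction)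

-- Counting orbits by invariant Boolean functions

module _ {c ℓ} (S : Setoid c ℓ) where
  open Setoid S using (_≈_) renaming (sym to ≈-sym)

  lookup-injective : ∀ {xs} → Unique S xs → ∀ {i j} → lookup xs i ≈ lookup xs j → i ≡ j
  lookup-injective (_ ∷ _)   {zero}  {zero}  _ = refl
  lookup-injective (x∉ ∷ _)  {zero}  {suc j} p = contradiction p (All.lookup x∉ (∈-lookup j))
  lookup-injective (x∉ ∷ _)  {suc i} {zero}  p = contradiction (≈-sym p) (All.lookup x∉ (∈-lookup i))
  lookup-injective (_ ∷ xs!) {suc i} {suc j} p = cong suc (lookup-injective xs! p)

funToFin-cong : ∀ {m n} {f g : Fin m → Fin n} → f ≗ g → funToFin f ≡ funToFin g
funToFin-cong {zero}  _ = refl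
funToFin-cong {suc m} p = cong₂ combine (p zero) (funToFin-cong (p ∘ suc))

-- An injection between the Boolean functions gives 2^k ≤ 2^l, and powers of 2 are strictly
-- monotone. Functions are coded as numbers below 2^k, so that injectivity up to pointwise equality
-- is enough.
Predicates-≤ : ∀ {k l} (Φ : (Fin k → Bool) → (Fin l → Bool)) →
               (∀ {u v} → Φ u ≗ Φ v → u ≗ v) → k ≤ l
Predicates-≤ {k} {l} Φ Φ-injective = ℕ.≮⇒≥ λ l<k →
  ℕ.<⇒≱ (ℕ.^-monoʳ-< 2 ℕ.≤-refl l<k) (Fin.injective⇒≤ code-injective)
  where
  open Inverse Fin.2↔Bool
  decode : Fin (2 ^ k) → Fin k → Bool
  decode i = to ∘ finToFun i
  code : Fin (2 ^ k) → Fin (2 ^ l)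
  code i = funToFin (from ∘ Φ (decode i))
  code-injective : ∀ {i j} → code i ≡ code j → i ≡ j
  code-injective {i} {j} eq = begin
    i                                       ≡⟨ Fin.funToFin-finToFin {k} i ⟨
    funToFin (finToFun {2} {k} i)           ≡⟨ funToFin-cong (λ a → trans (sym (strictlyInverseʳ _)) (trans (cong from (Φ-injective Φ≗ a)) (strictlyInverseʳ _))) ⟩
    funToFin (finToFun {2} {k} j)           ≡⟨ Fin.funToFin-finToFin {k} j ⟩
    j                                       ∎
    where
    open ≡-Reasoning
    Φ≗ : Φ (decode i) ≗ Φ (decode j)
    Φ≗ a = begin
      Φ (decode i) a               ≡⟨ strictlyInverseˡ _ ⟨
      to (from (Φ (decode i) a))   ≡⟨ cong to (Fin.finToFun-funToFin (from ∘ Φ (decode i)) a) ⟨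
      to (finToFun (code i) a)     ≡⟨ cong (λ z → to (finToFun z a)) eq ⟩
      to (finToFun (code j) a)     ≡⟨ cong to (Fin.finToFun-funToFin (from ∘ Φ (decode j)) a) ⟩
      to (from (Φ (decode j) a))   ≡⟨ strictlyInverseˡ _ ⟩
      Φ (decode j) a               ∎

∈-bools : ∀ b → b ∈ false ∷ true ∷ []
∈-bools false = here refl
∈-bools true  = there (here refl)

∈-corners : ∀ {n} (x : Corner n) → x ∈ corners n
∈-corners (e , i , s) = ∈-cartesianProduct⁺ (∈-allFin e) (∈-cartesianProduct⁺ (∈-bools i) (∈-bools s))

Invariant : ∀ {n} → (Corner n → Corner n) → (Corner n → Bool) → Set
Invariant f F = F ∘ f ≗ F

module Orbits {n} (f g : Corner n → Corner n) where

  private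
    DS : DecSetoid _ _
    DS = record { isDecEquivalence = record { isEquivalence = EqC.isEquivalence (Step f g) ; _≟_ = sameOrbit? f g } }

    S = DecSetoid.setoid DS

    ∈-deduplicate : ∀ x → SetoidMembership._∈_ S x (deduplicate (sameOrbit? f g) (corners n))
    ∈-deduplicate = deduplicate⁺ DS (λ x → Any.map (λ { refl → EqC.reflexive _ }) (∈-corners x))

  rep : Fin (#orbits f g) → Corner n
  rep = lookup (deduplicate (sameOrbit? f g) (corners n))

  orbit : Corner n → Fin (#orbits f g)
  orbit x = Any.index (∈-deduplicate x)

  rep-orbit : ∀ x → SameOrbit f g x (rep (orbit x))
  rep-orbit x = lookup-index (∈-deduplicate x)

  rep-injective : ∀ {i j} → SameOrbit f g (rep i) (rep j) → i ≡ j
  rep-injective = lookup-injective S (UniqueDec.deduplicate-! DS (corners n))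

  orbit-cong : ∀ {x y} → SameOrbit f g x y → orbit x ≡ orbit y
  orbit-cong {x} {y} p = rep-injective
    (S.trans (S.sym (rep-orbit x)) (S.trans p (rep-orbit y)))
    where module S = DecSetoid DS

  orbit-rep : ∀ i → orbit (rep i) ≡ i
  orbit-rep i = sym (rep-injective (rep-orbit (rep i)))

  invariant-SameOrbit : ∀ {F} → Invariant f F → Invariant g F →
                        ∀ {x y} → SameOrbit f g x y → F x ≡ F y
  invariant-SameOrbit {F} Ff Fg =
    EqC.gfold isEquivalence F λ { (inj₁ refl) → sym (Ff _) ; (inj₂ refl) → sym (Fg _) }

-- Functions invariant under `f` and `g` are exactly the Boolean functions of the orbit, so `Φ`
-- induces an injection between Boolean functions on the two sets of orbits, and `Predicates-≤`
-- applies.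
#orbits-≤ : ∀ {m n} {f g : Corner m → Corner m} {f′ g′ : Corner n → Corner n}
            (Φ : (Corner m → Bool) → (Corner n → Bool)) →
            (∀ {F} → Invariant f F → Invariant g F → Invariant f′ (Φ F) × Invariant g′ (Φ F)) →
            (∀ {F H} → Invariant f F → Invariant g F → Invariant f H → Invariant g H → Φ F ≗ Φ H → F ≗ H) →
            #orbits f g ≤ #orbits f′ g′
#orbits-≤ {f = f} {g} {f′} {g′} Φ Φ-invariant Φ-injective = Predicates-≤ (λ u → Φ (u ∘ O.orbit) ∘ O′.rep)
  λ {u} {v} eq i → subst (λ j → u j ≡ v j) (O.orbit-rep i)
    (Φ-injective (inv-f u) (inv-g u) (inv-f v) (inv-g v) (λ y → begin
      Φ (u ∘ O.orbit) y                     ≡⟨ same u y ⟩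
      Φ (u ∘ O.orbit) (O′.rep (O′.orbit y)) ≡⟨ eq (O′.orbit y) ⟩
      Φ (v ∘ O.orbit) (O′.rep (O′.orbit y)) ≡⟨ same v y ⟨
      Φ (v ∘ O.orbit) y                     ∎) (O.rep i))
  where
  open ≡-Reasoning
  module O = Orbits f g
  module O′ = Orbits f′ g′
  inv-f : ∀ u → Invariant f (u ∘ O.orbit)
  inv-f u x = cong u (sym (O.orbit-cong (EqC.return (inj₁ refl))))
  inv-g : ∀ u → Invariant g (u ∘ O.orbit)
  inv-g u x = cong u (sym (O.orbit-cong (EqC.return (inj₂ refl))))
  same : ∀ u y → Φ (u ∘ O.orbit) y ≡ Φ (u ∘ O.orbit) (O′.rep (O′.orbit y))
  same u y = let p , q = Φ-invariant (inv-f u) (inv-g u) in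
    O′.invariant-SameOrbit p q (O′.rep-orbit y)

-- Walking around the vertex of a bouquet

module _ {n : ℕ} where

  acrossEnd-involutive : ∀ (x : Corner n) → acrossEnd (acrossEnd x) ≡ x
  acrossEnd-involutive (e , i , s) = cong (λ t → e , i , t) (Bool.not-involutive s)

  acrossEnd-≢ : ∀ (x : Corner n) → x ≢ acrossEnd x
  acrossEnd-≢ (e , i , false) ()
  acrossEnd-≢ (e , i , true)  ()

  end : Corner n → Fin n × Bool
  end (e , i , s) = e , i

  end-≡ : ∀ x y → end x ≡ end y → x ≡ y ⊎ x ≡ acrossEnd y
  end-≡ (e , i , s) (e , i , t) refl with s Bool.≟ t
  ... | yes refl = inj₁ refl
  ... | no  s≢t  = inj₂ (cong (λ u → e , i , u) (Bool.¬-not s≢t))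

  endIndex : Fin n × Bool → Fin (2 * n)
  endIndex (e , i) = combine (Inverse.from Fin.2↔Bool i) e

  endIndex-injective : ∀ {u v} → endIndex u ≡ endIndex v → u ≡ v
  endIndex-injective {e , i} {e′ , i′} eq
    with p , q ← Fin.combine-injective (Inverse.from Fin.2↔Bool i) e _ _ eq =
    cong₂ _,_ q (trans (sym (strictlyInverseˡ i)) (trans (cong to p) (strictlyInverseˡ i′)))
    where open Inverse Fin.2↔Bool

-- The side `false` is an arbitrary choice: the corner only serves to represent one of the 2n ribbon
-- ends.
cornerOf : ∀ n → Fin (2 * n) → Corner n
cornerOf n c = let i , e = remQuot {2} n c in e , Inverse.to Fin.2↔Bool i , false

endIndex-cornerOf : ∀ n c → endIndex (end (cornerOf n c)) ≡ c
endIndex-cornerOf n c = trans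
  (cong (λ j → combine j (proj₂ ie)) (Inverse.strictlyInverseʳ Fin.2↔Bool (proj₁ ie)))
  (Fin.combine-remQuot {2} n c)
  where ie = remQuot {2} n c

module Walk (G : RibbonGraph) where

  private
    n = #edges G

  at : Corner n → ℕ → Corner n
  at = iterate (next G)

  at-+ : ∀ x j k → at x (j + k) ≡ at (at x j) k
  at-+ x zero    k = refl
  at-+ x (suc j) k = at-+ (next G x) j k

  at-suc : ∀ x k → at x (suc k) ≡ next G (at x k)
  at-suc x zero    = refl
  at-suc x (suc k) = at-suc (next G x) k

  arc-next : ∀ x → arc G (next G x) ≡ acrossEnd x
  arc-next x = arc-involutive G (acrossEnd x)

  next-injective : ∀ {x y} → next G x ≡ next G y → x ≡ y
  next-injective {x} {y} eq = begin
    x                               ≡⟨ acrossEnd-involutive x ⟨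
    acrossEnd (acrossEnd x)         ≡⟨ cong acrossEnd (arc-next x) ⟨
    acrossEnd (arc G (next G x))    ≡⟨ cong (acrossEnd ∘ arc G) eq ⟩
    acrossEnd (arc G (next G y))    ≡⟨ cong acrossEnd (arc-next y) ⟩
    acrossEnd (acrossEnd y)         ≡⟨ acrossEnd-involutive y ⟩
    y                               ∎
    where open ≡-Reasoning

  at-injective : ∀ {x y} k → at x k ≡ at y k → x ≡ y
  at-injective zero    eq = eq
  at-injective (suc k) eq = next-injective (at-injective k eq)

  -- Crossing an end reverses the direction of travel, so `acrossEnd` conjugates `next` into its
  -- inverse.
  next-acrossEnd-next : ∀ x → next G (acrossEnd (next G x)) ≡ acrossEnd x
  next-acrossEnd-next x = trans (cong (arc G) (acrossEnd-involutive (next G x))) (arc-next x)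

  -- A walk that met a ribbon end in both directions would reverse itself halfway.
  at-≢-acrossEnd : ∀ x k → at x k ≢ acrossEnd x
  -- According to the parity of `k`, the halfway point is a corner fixed by `acrossEnd` or one fixed
  -- by `arc`; neither exists.
  at-≢-acrossEnd x zero          eq = acrossEnd-≢ x eq
  at-≢-acrossEnd x (suc zero)    eq = arc-fixedFree G (acrossEnd x) eq
  at-≢-acrossEnd x (suc (suc k)) eq = at-≢-acrossEnd (next G x) k
    (next-injective (trans (sym (at-suc (next G x) k)) (trans eq (sym (next-acrossEnd-next x)))))

  -- An end has only two corners. Meeting the same one again allows the first `j` steps to be
  -- cancelled by injectivity; meeting the opposite one is excluded by `at-≢-acrossEnd`.
  at-end-period : ∀ x {j k} → j ≤ k → end (at x j) ≡ end (at x k) → at x (k ∸ j) ≡ x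
  at-end-period x {j} {k} j≤k eq with end-≡ (at x k) (at x j) (sym eq)
  ... | inj₁ p = at-injective j (trans (sym (at-+ x (k ∸ j) j))
                   (trans (cong (at x) (ℕ.m∸n+n≡m j≤k)) p))
  ... | inj₂ p = contradiction (trans (sym (at-+ x j (k ∸ j))) (trans (cong (at x) (ℕ.m+[n∸m]≡n j≤k)) p))
                   (at-≢-acrossEnd (at x j) (k ∸ j))

  at-≢-acrossEnd-at : ∀ x j k → at x j ≢ acrossEnd (at x k)
  at-≢-acrossEnd-at x j k eq with ℕ.≤-total j k
  ... | inj₁ j≤k = at-≢-acrossEnd (at x j) (k ∸ j) (begin
    at (at x j) (k ∸ j)        ≡⟨ at-+ x j (k ∸ j) ⟨
    at x (j + (k ∸ j))         ≡⟨ cong (at x) (ℕ.m+[n∸m]≡n j≤k) ⟩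
    at x k                     ≡⟨ acrossEnd-involutive (at x k) ⟨
    acrossEnd (acrossEnd (at x k))   ≡⟨ cong acrossEnd eq ⟨
    acrossEnd (at x j)         ∎)
    where open ≡-Reasoning
  ... | inj₂ k≤j = at-≢-acrossEnd (at x k) (j ∸ k) (begin
    at (at x k) (j ∸ k)        ≡⟨ at-+ x k (j ∸ k) ⟨
    at x (k + (j ∸ k))         ≡⟨ cong (at x) (ℕ.m+[n∸m]≡n k≤j) ⟩
    at x j                     ≡⟨ eq ⟩
    acrossEnd (at x k)         ∎)
    where open ≡-Reasoning

  private
    -- The first 2n + 1 positions meet only 2n ends, so some end is met twice.
    period : ∀ x → ∃[ N ] 0 < N × N ≤ 2 * n × at x N ≡ x
    period x with Fin.pigeonhole (ℕ.n<1+n (2 * n)) (λ k → endIndex (end (at x (toℕ k))))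
    ... | i , j , i<j , eq = toℕ j ∸ toℕ i , ℕ.m<n⇒0<n∸m i<j
        , ℕ.≤-trans (ℕ.m∸n≤m (toℕ j) (toℕ i)) (Fin.toℕ≤pred[n] j)
        , at-end-period x (ℕ.<⇒≤ i<j) (endIndex-injective eq)

  module _ (connected : ∀ x y → SameOrbit (arc G) acrossEnd x y) where

    private
      -- The corners whose end is met during one period form a set closed under `arc` and
      -- `acrossEnd`, hence contain everything by connectedness.
      reach : ∀ x N → 0 < N → at x N ≡ x → ∀ y → ∃[ k ] k < N × end (at x k) ≡ end y
      reach x N@(suc m) _ atN y = Equivalence.to
        (EqC.gfold ⇔-isEquivalence Reached (λ { (inj₁ refl) → mk⇔ arc⁺ arc⁻ ; (inj₂ refl) → mk⇔ (λ p → p) (λ p → p) })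
          (connected x y))
        (0 , z<s , refl)
        where
        Reached : Corner n → Set
        Reached z = ∃[ k ] k < N × end (at x k) ≡ end z
        arc⁺ : ∀ {z} → Reached z → Reached (arc G z)
        -- From the position at time `k`, `arc` leads back to the previous end; from the opposite
        -- corner it leads on to the next end. Both wrap around modulo `N`.
        arc⁺ {z} (k , k<N , eq) with end-≡ z (at x k) (sym eq)
        arc⁺ (zero , _ , _)    | inj₁ refl = m , ℕ.n<1+n m ,
          cong end (trans (sym (arc-next (at x m))) (cong (arc G) (trans (sym (at-suc x m)) atN)))
        arc⁺ (suc k , k<N , _) | inj₁ refl = k , ℕ.<-trans (ℕ.n<1+n k) k<N ,
          cong end (trans (sym (arc-next (at x k))) (cong (arc G) (sym (at-suc x k))))
        arc⁺ (k , k<N , _)     | inj₂ refl with ℕ.m≤n⇒m<n∨m≡n k<N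
        ... | inj₁ k+1<N = suc k , k+1<N , cong end (at-suc x k)
        ... | inj₂ refl  = 0 , z<s , cong end (trans (sym atN) (at-suc x k))
        arc⁻ : ∀ {z} → Reached (arc G z) → Reached z
        arc⁻ {z} p = subst Reached (arc-involutive G z) (arc⁺ p)

    -- All 2n ends are met within one period, and different ends at different times.
    period-≥ : ∀ x {N} → 0 < N → at x N ≡ x → 2 * n ≤ N
    period-≥ x {N} 0<N atN = Fin.injective⇒≤ position-injective
      where
      position : Fin (2 * n) → Fin N
      position c = let k , k<N , _ = reach x N 0<N atN (cornerOf n c) in fromℕ< k<N
      position-injective : ∀ {c d} → position c ≡ position d → c ≡ d
      position-injective {c} {d} eq
        with k , k<N , p ← reach x N 0<N atN (cornerOf n c) | l , l<N , q ← reach x N 0<N atN (cornerOf n d) = begin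
        c                             ≡⟨ endIndex-cornerOf n c ⟨
        endIndex (end (cornerOf n c))   ≡⟨ cong endIndex p ⟨
        endIndex (end (at x k))       ≡⟨ cong (endIndex ∘ end ∘ at x) (Fin.fromℕ<-injective k l k<N l<N eq) ⟩
        endIndex (end (at x l))       ≡⟨ cong endIndex q ⟩
        endIndex (end (cornerOf n d))   ≡⟨ endIndex-cornerOf n d ⟩
        d                             ∎
        where open ≡-Reasoning

    private
      period-≡ : ∀ x → 0 < 2 * n × at x (2 * n) ≡ x
      period-≡ x with period x
      ... | N , 0<N , N≤2n , atN = subst (λ M → 0 < M × at x M ≡ x) (ℕ.≤-antisym N≤2n (period-≥ x 0<N atN)) (0<N , atN)

    -- Unfolding these search procedures during conversion exhausts memory.
    opaque
      at-2n : ∀ x → at x (2 * n) ≡ x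
      at-2n x = proj₂ (period-≡ x)

      locate : ∀ x y → ∃[ k ] k < 2 * n × end (at x k) ≡ end y
      locate x y = reach x (2 * n) (proj₁ (period-≡ x)) (at-2n x) y

      -- Two meetings with one end within a turn would give a positive period shorter than 2n.
      at-end-injective : ∀ x {j k} → j < 2 * n → k < 2 * n → end (at x j) ≡ end (at x k) → j ≡ k
      at-end-injective x {j} {k} j<2n k<2n eq with ℕ.<-cmp j k
      ... | tri≈ _ j≡k _ = j≡k
      ... | tri< j<k _ _ = contradiction (period-≥ x (ℕ.m<n⇒0<n∸m j<k) (at-end-period x (ℕ.<⇒≤ j<k) eq))
                             (ℕ.<⇒≱ (ℕ.≤-<-trans (ℕ.m∸n≤m k j) k<2n))
      ... | tri> _ _ k<j = contradiction (period-≥ x (ℕ.m<n⇒0<n∸m k<j) (at-end-period x (ℕ.<⇒≤ k<j) (sym eq)))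
                             (ℕ.<⇒≱ (ℕ.≤-<-trans (ℕ.m∸n≤m j k) j<2n))

-- Potentials that jump at the ends of a single ribbon

δ : ∀ {n} → Fin n → Fin n → Bool
δ a b = does (a Fin.≟ b)

δ-≡ : ∀ {n} {a b : Fin n} → a ≡ b → δ a b ≡ true
δ-≡ = dec-true (_ Fin.≟ _)

δ-≢ : ∀ {n} {a b : Fin n} → a ≢ b → δ a b ≡ false
δ-≢ = dec-false (_ Fin.≟ _)

xor-cancelˡ : ∀ a b → a xor (a xor b) ≡ b
xor-cancelˡ a b = trans (sym (Bool.xor-assoc a a b)) (cong (_xor b) (Bool.xor-same a))

side : ∀ {n} → Corner n → Bool
side (e , i , s) = i

opaque
  -- There is at most one orbit, so every orbit index is 0 and all corners share a representative.
  bouquet-connected : (B : Bouquet) → let G = proj₁ B in ∀ x y → SameOrbit (arc G) acrossEnd x y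
  bouquet-connected (G , v≡1) x y = EqC.transitive _ (rep-orbit x)
    (subst (λ i → SameOrbit (arc G) acrossEnd (rep i) y) (Fin.toℕ-injective (trans (first (orbit y)) (sym (first (orbit x)))))
      (EqC.symmetric _ (rep-orbit y)))
    where
    open Orbits (arc G) acrossEnd
    first : ∀ (i : Fin (#orbits (arc G) acrossEnd)) → toℕ i ≡ 0
    first i = ℕ.n<1⇒n≡0 (ℕ.<-≤-trans (Fin.toℕ<n i) (subst (#orbits (arc G) acrossEnd ≤_) v≡1 (ℕ.m≤n+m _ (#isolated G))))

-- Without edges the single vertex is isolated; with an edge, the orbit of one of its corners
-- already accounts for that vertex.
bouquet-#isolated : (B : Bouquet) → #isolated (proj₁ B) ≡ 1 ∸ #edges (proj₁ B)
bouquet-#isolated (record { #edges = zero }    , v≡1) = trans (sym (ℕ.+-identityʳ _)) v≡1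
bouquet-#isolated (G@record { #edges = suc n } , v≡1) = trans (ℕ.n≤0⇒n≡0 (ℕ.+-cancelʳ-≤ 1 _ 0
  (subst (#isolated G + 1 ≤_) v≡1 (ℕ.+-monoʳ-≤ (#isolated G)
    (ℕ.≤-<-trans z≤n (Fin.toℕ<n (Orbits.orbit (arc G) acrossEnd (Fin.zero , false , false))))))))
  (sym (ℕ.0∸n≡0 n))

module Potential (B : Bouquet) where

  private
    G = proj₁ B
    n = #edges G
    connected = bouquet-connected B

  open Walk G

  module _ (b : Fin n) where

    private
      x₀ : Corner n
      x₀ = b , false , false

      return : ∃[ k ] k < 2 * n × end (at x₀ k) ≡ (b , true)
      return = locate connected x₀ (b , true , false)

      q = proj₁ return
      q<2n = proj₁ (proj₂ return)
      at-q = proj₂ (proj₂ return)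

      -- Starting at x₀, a full turn crosses the ends of b at the times 0 and q only.
      between? : ∀ k → _
      between? k = (0 ℕ.<? k) ×-dec (k ℕ.≤? q)

      between : ℕ → Bool
      between k = does (between? k)

      q>0 : 0 < q
      q>0 = ℕ.n≢0⇒n>0 λ q≡0 → contradiction (trans (sym at-q) (cong (end ∘ at x₀) q≡0)) λ ()

      visit : ∀ {k} → k < 2 * n → edge (at x₀ k) ≡ b → k ≡ 0 ⊎ k ≡ q
      visit {k} k<2n e with side (at x₀ k) in eq
      ... | false = inj₁ (at-end-injective connected x₀ k<2n (ℕ.≤-<-trans z≤n q<2n) (cong₂ _,_ e eq))
      ... | true  = inj₂ (at-end-injective connected x₀ k<2n q<2n (trans (cong₂ _,_ e eq) (sym at-q)))

      -- The interval 0 < k ≤ q is entered just after the crossing at time 0 and left just after the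
      -- crossing at time `q`, the two visits to `b`.
      between-suc : ∀ {k} → k < 2 * n → between (suc k) ≡ δ (edge (at x₀ k)) b xor between k
      between-suc {k} k<2n with edge (at x₀ k) Fin.≟ b
      ... | yes e with visit k<2n e
      ...   | inj₁ refl = dec-true (between? 1) (z<s , q>0)
      ...   | inj₂ refl = trans (dec-false (between? (suc q)) (ℕ.n≮n _ ∘ proj₂))
                            (cong not (sym (dec-true (between? q) (q>0 , ℕ.≤-refl))))
      between-suc {k} k<2n | no ¬e with ℕ.<-cmp k q
      ... | tri< k<q _ _ = trans (dec-true (between? (suc k)) (z<s , k<q))
                            (sym (dec-true (between? k) (k>0 , ℕ.<⇒≤ k<q)))
        where k>0 = ℕ.n≢0⇒n>0 λ { refl → ¬e refl }
      ... | tri≈ _ refl _ = contradiction (cong proj₁ at-q) ¬e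
      ... | tri> _ _ q<k = trans (dec-false (between? (suc k)) (ℕ.<⇒≱ (ℕ.m<n⇒m<1+n q<k) ∘ proj₂))
                            (sym (dec-false (between? k) (ℕ.<⇒≱ q<k ∘ proj₂)))

    opaque
      -- The end of `y` is met at a unique time `k` of the turn. The corner where the walk arrives
      -- gets the value before the crossing, `between k`, and the opposite corner the value after
      -- it, `between (suc k)`.
      potential : Corner n → Bool
      potential y = let k = proj₁ (locate connected x₀ y) in
        if does (y ≟ᶜ at x₀ k) then between k else between (suc k)

      potential-at : ∀ {k} → k < 2 * n → potential (at x₀ k) ≡ between k
      potential-at {k} k<2n with locate connected x₀ (at x₀ k)
      ... | j , j<2n , eq with at-end-injective connected x₀ j<2n k<2n eq
      ... | refl rewrite dec-true (at x₀ j ≟ᶜ at x₀ j) refl = refl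

      potential-acrossEnd-at : ∀ {k} → k < 2 * n → potential (acrossEnd (at x₀ k)) ≡ between (suc k)
      potential-acrossEnd-at {k} k<2n with locate connected x₀ (acrossEnd (at x₀ k))
      ... | j , j<2n , eq with at-end-injective connected x₀ j<2n k<2n eq
      ... | refl rewrite dec-false (acrossEnd (at x₀ j) ≟ᶜ at x₀ j) (acrossEnd-≢ (at x₀ j) ∘ sym) = refl

    private
      potential-next : ∀ {k} → k < 2 * n → potential (next G (at x₀ k)) ≡ potential (acrossEnd (at x₀ k))
      potential-next {k} k<2n = trans (cong potential (sym (at-suc x₀ k))) (trans (lemma (ℕ.m≤n⇒m<n∨m≡n k<2n)) (sym (potential-acrossEnd-at k<2n)))
        where
        lemma : suc k < 2 * n ⊎ suc k ≡ 2 * n → potential (at x₀ (suc k)) ≡ between (suc k)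
        lemma (inj₁ k+1<2n) = potential-at k+1<2n
        -- Here the turn closes up: `between` is false at time 0 and again at time 2n, because q <
        -- 2n.
        lemma (inj₂ eq)     = begin
          potential (at x₀ (suc k))   ≡⟨ cong (potential ∘ at x₀) eq ⟩
          potential (at x₀ (2 * n))   ≡⟨ cong potential (at-2n connected x₀) ⟩
          potential (at x₀ 0)         ≡⟨ potential-at (ℕ.≤-<-trans z≤n k<2n) ⟩
          between 0                   ≡⟨ dec-false (between? 0) (ℕ.n≮n 0 ∘ proj₁) ⟩
          false                       ≡⟨ dec-false (between? (suc k)) (ℕ.<⇒≱ (subst (q <_) (sym eq) q<2n) ∘ proj₂) ⟨
          between (suc k)             ∎
          where open ≡-Reasoning

      previous : ∀ {k} → k < 2 * n → ∃[ j ] j < 2 * n × at x₀ k ≡ next G (at x₀ j)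
      previous {suc k} k+1<2n = k , ℕ.<-trans (ℕ.n<1+n k) k+1<2n , at-suc x₀ k
      previous {zero}  0<2n   = 2 * n ∸ 1 , ℕ.≤-reflexive eq ,
        trans (sym (at-2n connected x₀)) (trans (cong (at x₀) (sym eq)) (at-suc x₀ (2 * n ∸ 1)))
        where eq = ℕ.m+[n∸m]≡n {1} 0<2n

    -- Every free arc joins the exit corner of one end to the entry corner of the next, and no
    -- crossing happens in between. For an entry corner the arc is followed backwards, to the
    -- previous position.
    potential-arc : Invariant (arc G) potential
    potential-arc y with locate connected x₀ y
    ... | k , k<2n , eq with end-≡ y (at x₀ k) (sym eq)
    ...   | inj₂ refl = potential-next {k} k<2n
    ...   | inj₁ refl with previous {k} k<2n
    ...     | j , j<2n , p = begin
      potential (arc G (at x₀ k))                ≡⟨ cong (potential ∘ arc G) p ⟩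
      potential (arc G (next G (at x₀ j)))       ≡⟨ cong potential (arc-next (at x₀ j)) ⟩
      potential (acrossEnd (at x₀ j))            ≡⟨ potential-next {j} j<2n ⟨
      potential (next G (at x₀ j))               ≡⟨ cong potential p ⟨
      potential (at x₀ k)                        ∎
      where open ≡-Reasoning

    potential-acrossEnd : ∀ y → potential (acrossEnd y) ≡ δ (edge y) b xor potential y
    potential-acrossEnd y with locate connected x₀ y
    ... | k , k<2n , eq with end-≡ y (at x₀ k) (sym eq)
    ...   | inj₁ refl = begin
      potential (acrossEnd (at x₀ k))                   ≡⟨ potential-acrossEnd-at k<2n ⟩
      between (suc k)                                   ≡⟨ between-suc k<2n ⟩
      δ (edge (at x₀ k)) b xor between k                ≡⟨ cong (δ (edge (at x₀ k)) b xor_) (potential-at k<2n) ⟨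
      δ (edge (at x₀ k)) b xor potential (at x₀ k)      ∎
      where open ≡-Reasoning
    ...   | inj₂ refl = begin
      potential (acrossEnd (acrossEnd (at x₀ k)))        ≡⟨ cong potential (acrossEnd-involutive (at x₀ k)) ⟩
      potential (at x₀ k)                                ≡⟨ potential-at k<2n ⟩
      between k                                          ≡⟨ xor-cancelˡ (δ (edge (at x₀ k)) b) (between k) ⟨
      δ (edge (at x₀ k)) b xor (δ (edge (at x₀ k)) b xor between k) ≡⟨ cong (δ (edge (at x₀ k)) b xor_) (between-suc k<2n) ⟨
      δ (edge (at x₀ k)) b xor between (suc k)           ≡⟨ cong (δ (edge (at x₀ k)) b xor_) (potential-acrossEnd-at k<2n) ⟨
      δ (edge (at x₀ k)) b xor potential (acrossEnd (at x₀ k)) ∎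
      where open ≡-Reasoning

  -- Potentials along a walk and the interlacement matrix

  potential-step : ∀ b x k → potential b (at x (suc k)) ≡ δ (edge (at x k)) b xor potential b (at x k)
  potential-step b x k = begin
    potential b (at x (suc k))                      ≡⟨ cong (potential b) (at-suc x k) ⟩
    potential b (arc G (acrossEnd (at x k)))        ≡⟨ potential-arc b (acrossEnd (at x k)) ⟩
    potential b (acrossEnd (at x k))                ≡⟨ potential-acrossEnd b (at x k) ⟩
    δ (edge (at x k)) b xor potential b (at x k)    ∎
    where open ≡-Reasoning

  potential-visit : ∀ b x k → edge (at x k) ≡ b → potential b (at x (suc k)) ≡ not (potential b (at x k))
  potential-visit b x k e = trans (potential-step b x k) (cong (_xor potential b (at x k)) (δ-≡ e))

  potential-constant : ∀ b x {j k} → j ≤ k → (∀ i → j ≤ i → i < k → edge (at x i) ≢ b) →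
                       potential b (at x k) ≡ potential b (at x j)
  potential-constant b x {j} {k} j≤k none with ℕ.m≤n⇒m<n∨m≡n j≤k
  ... | inj₂ refl = refl
  potential-constant b x {j} {suc k} _ none | inj₁ j<k+1 = begin
    potential b (at x (suc k))                      ≡⟨ potential-step b x k ⟩
    δ (edge (at x k)) b xor potential b (at x k)    ≡⟨ cong (_xor potential b (at x k)) (δ-≢ (none k j≤k (ℕ.n<1+n k))) ⟩
    potential b (at x k)                            ≡⟨ potential-constant b x j≤k (λ i j≤i i<k → none i j≤i (ℕ.m<n⇒m<1+n i<k)) ⟩
    potential b (at x j)                            ∎
    where
    open ≡-Reasoning
    j≤k = s≤s⁻¹ j<k+1

  potential-end : ∀ b {y z} → edge y ≢ b → end y ≡ end z → potential b y ≡ potential b z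
  potential-end b {y} {z} y≢b eq with end-≡ y z eq
  ... | inj₁ p    = cong (potential b) p
  ... | inj₂ refl = trans (potential-acrossEnd b z) (cong (_xor potential b z) (δ-≢ y≢b))

  -- The entry M_ab, taken here as the change of the potential of `b` along a side of `a`. The
  -- lemmas below identify it with interlacing off the diagonal and with twisting on it.
  interlacement : Fin n → Fin n → Bool
  interlacement a b = potential b (a , false , false) xor potential b (a , true , false)

  -- For the side `false` this unfolds the definition. Passing to the side `true` crosses both ends
  -- of the ribbon, which adds the same `δ a b` to both values.
  potential-alongSide : ∀ b y → potential b (alongSide y) ≡ interlacement (edge y) b xor potential b y
  potential-alongSide b (a , i , s) = solve s
    where
    P = potential b
    swap : ∀ u v → u ≡ (v xor u) xor v
    swap false false = refl
    swap false true  = refl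
    swap true  false = refl
    swap true  true  = refl
    swap′ : ∀ u v → u ≡ (u xor v) xor v
    swap′ false false = refl
    swap′ false true  = refl
    swap′ true  false = refl
    swap′ true  true  = refl
    shift : ∀ d u w v → u ≡ w xor v → d xor u ≡ w xor (d xor v)
    shift false u w     v refl = refl
    shift true  u false v refl = refl
    shift true  u true  v refl = refl
    solve-false : ∀ i → P (a , not i , false) ≡ interlacement a b xor P (a , i , false)
    solve-false false = swap (P (a , true , false)) (P (a , false , false))
    solve-false true  = swap′ (P (a , false , false)) (P (a , true , false))
    solve : ∀ s → P (a , not i , s) ≡ interlacement a b xor P (a , i , s)
    solve false = solve-false i
    solve true  = trans (potential-acrossEnd b (a , not i , false))
      (trans (shift (δ a b) _ (interlacement a b) (P (a , i , false)) (solve-false i))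
        (cong (interlacement a b xor_) (sym (potential-acrossEnd b (a , i , false)))))

  -- A ribbon has two ends, each met once per turn, so the distinct times `p` and `r` exhaust the
  -- visits to their common edge.
  visits : ∀ x {p r k} → p < 2 * n → r < 2 * n → k < 2 * n → p ≢ r →
           edge (at x p) ≡ edge (at x r) → edge (at x k) ≡ edge (at x p) → k ≡ p ⊎ k ≡ r
  visits x {p} {r} {k} p<2n r<2n k<2n p≢r pr kp with side (at x k) Bool.≟ side (at x p)
  ... | yes s = inj₁ (at-end-injective connected x k<2n p<2n (cong₂ _,_ kp s))
  ... | no ¬s = inj₂ (at-end-injective connected x k<2n r<2n (cong₂ _,_ (trans kp pr)
                  (trans (Bool.¬-not ¬s) (sym (Bool.¬-not λ s → p≢r (sym (at-end-injective connected x r<2n p<2n (cong₂ _,_ (sym pr) s))))))))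

  -- Up to time `k` the edge of `x` is crossed only at time 0, since its other visit in this turn is
  -- at `k` itself.
  potential-return : ∀ x {k} → k < 2 * n → k ≢ 0 → edge (at x k) ≡ edge x →
                     potential (edge x) (at x k) ≡ not (potential (edge x) x)
  potential-return x {k} k<2n k≢0 e = trans
    (potential-constant (edge x) x k>0 λ i 0<i i<k ei → excluded 0<i i<k (visits x 0<2n k<2n (ℕ.<-trans i<k k<2n) (k≢0 ∘ sym) (sym e) ei))
    (potential-visit (edge x) x 0 refl)
    where
    k>0 = ℕ.n≢0⇒n>0 k≢0
    0<2n = ℕ.<-trans k>0 k<2n
    excluded : ∀ {i} → 0 < i → i < k → ¬ (i ≡ 0 ⊎ i ≡ k)
    excluded 0<i _   (inj₁ refl) = ℕ.n≮n 0 0<i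
    excluded _   i<k (inj₂ refl) = ℕ.n≮n _ i<k

  -- Between `x` and the other end of `a`, at time `q`, exactly one end of `b` is crossed, namely at
  -- `p`. At an end of `a` the potential of `b` does not depend on the corner, as `a` and `b`
  -- differ.
  Interlaced⇒interlacement : ∀ {a b} → a ≢ b → Interlaced B a b → interlacement a b ≡ true
  Interlaced⇒interlacement {a} {b} a≢b (x , p , q , r , p<q , q<r , r<2n , refl , ep , eq , er) =
    trans (xor-move (potential-alongSide b x)) (trans (cong (_xor potential b x) far) (Bool.xor-inverseˡ (potential b x)))
    where
    open ≡-Reasoning
    q<2n = ℕ.<-trans q<r r<2n
    p<2n = ℕ.<-trans p<q q<2n
    xor-move : ∀ {u w v} → u ≡ w xor v → w ≡ u xor v
    xor-move {w = w} {v} refl = trans (sym (Bool.xor-identityʳ w))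
      (trans (cong (w xor_) (sym (Bool.xor-same v))) (sym (Bool.xor-assoc w v v)))
    only : ∀ {i} → i < 2 * n → edge (at x i) ≡ b → i ≡ p ⊎ i ≡ r
    only i<2n ei = visits x p<2n r<2n i<2n (ℕ.<⇒≢ (ℕ.<-trans p<q q<r)) (trans ep (sym er)) (trans ei (sym ep))
    before : ∀ i → 0 ≤ i → i < p → edge (at x i) ≢ b
    before i _ i<p ei with only (ℕ.<-trans i<p p<2n) ei
    ... | inj₁ refl = ℕ.n≮n _ i<p
    ... | inj₂ refl = ℕ.<-asym i<p (ℕ.<-trans p<q q<r)
    after : ∀ i → p < i → i < q → edge (at x i) ≢ b
    after i p<i i<q ei with only (ℕ.<-trans i<q q<2n) ei
    ... | inj₁ refl = ℕ.n≮n _ p<i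
    ... | inj₂ refl = ℕ.<-asym i<q q<r
    opposite : side (at x q) ≡ not (side x)
    opposite = Bool.¬-not λ s → ℕ.n≮0 (subst (p <_) (at-end-injective connected x q<2n (ℕ.≤-<-trans z≤n q<2n) (cong₂ _,_ eq s)) p<q)
    far : potential b (alongSide x) ≡ not (potential b x)
    far = begin
      potential b (alongSide x)     ≡⟨ potential-end b a≢b (cong₂ _,_ (sym eq) (sym opposite)) ⟩
      potential b (at x q)          ≡⟨ potential-constant b x p<q after ⟩
      potential b (at x (suc p))    ≡⟨ potential-visit b x p ep ⟩
      not (potential b (at x p))    ≡⟨ cong not (potential-constant b x z≤n before) ⟩
      not (potential b x)           ∎

  -- The potential of `b` differs between the two ends of `a`, so an end of `b` must be crossed both
  -- before and after time `q`; this forces p < q < r.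
  positions⇒Interlaced : ∀ {a b p q r} → a ≢ b → interlacement a b ≡ true →
    let x = a , false , false in
    q < 2 * n → end (at x q) ≡ (a , true) → p < r → r < 2 * n →
    edge (at x p) ≡ b → edge (at x r) ≡ b → Interlaced B a b
  positions⇒Interlaced {a} {b} {p} {q} {r} a≢b m q<2n eq p<r r<2n ep er = cases (ℕ.<-cmp p q) (ℕ.<-cmp q r)
    where
    x : Corner n
    x = a , false , false
    only : ∀ {i} → i < 2 * n → edge (at x i) ≡ b → i ≡ p ⊎ i ≡ r
    only i<2n ei = visits x (ℕ.<-trans p<r r<2n) r<2n i<2n (ℕ.<⇒≢ p<r) (trans ep (sym er)) (trans ei (sym ep))
    differ : potential b (at x q) ≢ potential b x
    differ same = contradiction (trans (sym m) (trans
      (cong (potential b x xor_) (trans (potential-end b a≢b (sym eq)) same)) (Bool.xor-same (potential b x)))) λ ()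
    cases : _ → _ → Interlaced B a b
    cases (tri≈ _ refl _) _ = contradiction (trans (sym (cong proj₁ eq)) ep) a≢b
    cases _ (tri≈ _ refl _) = contradiction (trans (sym (cong proj₁ eq)) er) a≢b
    cases (tri< p<q _ _) (tri< q<r _ _) = x , p , q , r , p<q , q<r , r<2n , refl , ep , cong proj₁ eq , er
    cases (tri> _ _ q<p) _ = contradiction (potential-constant b x z≤n none) differ
      where
      none : ∀ i → 0 ≤ i → i < q → edge (at x i) ≢ b
      none i _ i<q ei with only (ℕ.<-trans i<q q<2n) ei
      ... | inj₁ refl = ℕ.<-asym i<q q<p
      ... | inj₂ refl = ℕ.<-asym i<q (ℕ.<-trans q<p p<r)
    -- Both ends of `b` precede `q`, so nothing changes from `q` to the end of the turn, when the
    -- walk is back at `x`.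
    cases (tri< p<q _ _) (tri> _ _ r<q) = contradiction
      (trans (sym (potential-constant b x (ℕ.<⇒≤ q<2n) none)) (cong (potential b) (at-2n connected x))) differ
      where
      none : ∀ i → q ≤ i → i < 2 * n → edge (at x i) ≢ b
      none i q≤i i<2n ei with only i<2n ei
      ... | inj₁ refl = ℕ.<⇒≱ p<q q≤i
      ... | inj₂ refl = ℕ.<⇒≱ r<q q≤i

  interlacement⇒Interlaced : ∀ {a b} → a ≢ b → interlacement a b ≡ true → Interlaced B a b
  interlacement⇒Interlaced {a} {b} a≢b m
    with locate connected (a , false , false) (a , true , false)
       | locate connected (a , false , false) (b , false , false)
       | locate connected (a , false , false) (b , true , false)
  ... | q , q<2n , eq | p , p<2n , ep | r , r<2n , er with ℕ.<-cmp p r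
  ... | tri≈ _ refl _ = contradiction (trans (sym ep) er) λ ()
  ... | tri< p<r _ _  = positions⇒Interlaced a≢b m q<2n eq p<r r<2n (cong proj₁ ep) (cong proj₁ er)
  ... | tri> _ _ r<p  = positions⇒Interlaced a≢b m q<2n eq r<p p<2n (cong proj₁ er) (cong proj₁ ep)

  -- The walk never meets an end in both directions, so within the first turn it already arrives at
  -- `(a , true , s)`. By then the potential has flipped once, and this is the change along the side
  -- `s`.
  Twisted⇒interlacement : ∀ {a} → Twisted B a → interlacement a a ≡ true
  Twisted⇒interlacement {a} (s , k , atk) with locate connected (a , false , s) (a , true , s)
  ... | zero , _ , ()
  ... | j@(suc _) , j<2n , ej with end-≡ (at (a , false , s) j) (a , true , s) ej
  ...   | inj₂ p = contradiction (trans p (cong acrossEnd (sym atk))) (at-≢-acrossEnd-at (a , false , s) j k)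
  ...   | inj₁ p = trans (xor-move (trans (sym (cong (potential a) p)) (potential-return (a , false , s) j<2n (λ ()) (cong proj₁ ej)))
                     (potential-alongSide a (a , false , s))) refl
    where
    xor-move : ∀ {u w v} → u ≡ not v → u ≡ w xor v → w ≡ true
    xor-move {w = true} _ _ = refl
    xor-move {w = false} {false} refl ()
    xor-move {w = false} {true} refl ()

  interlacement⇒Twisted : ∀ {a} → interlacement a a ≡ true → Twisted B a
  interlacement⇒Twisted {a} m with locate connected (a , false , false) (a , true , false)
  ... | zero , _ , ()
  ... | j@(suc _) , j<2n , ej with end-≡ (at (a , false , false) j) (a , true , false) ej
  ...   | inj₁ p = false , j , p
  -- If the walk arrives at the corner opposite to `y`, the flip at time 0 and the flip across this
  -- end cancel. Then `x` and `y` have equal potential, against `m`.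
  ...   | inj₂ p = contradiction m (λ m → Bool.not-¬ {potential a (a , false , false)} refl (begin
    potential a x                              ≡⟨ Bool.not-involutive _ ⟨
    not (not (potential a x))                  ≡⟨ cong not (potential-return x j<2n (λ ()) (cong proj₁ ej)) ⟨
    not (potential a (at x j))                 ≡⟨ cong (not ∘ potential a) p ⟩
    not (potential a (acrossEnd y))            ≡⟨ cong not (potential-acrossEnd a y) ⟩
    not (δ a a xor potential a y)              ≡⟨ cong (λ d → not (d xor potential a y)) (δ-≡ {a = a} refl) ⟩
    not (not (potential a y))                  ≡⟨ Bool.not-involutive _ ⟩
    potential a y                              ≡⟨ potential-alongSide a x ⟩
    interlacement a a xor potential a x        ≡⟨ cong (_xor potential a x) m ⟩
    not (potential a x)                        ∎))
    where
    open ≡-Reasoning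
    x y : Corner n
    x = a , false , false
    y = a , true , false

-- Transport along an isomorphism of signed intersection graphs

open Sum (CommutativeRing.+-commutativeMonoid Bool.xor-∧-commutativeRing)
  using (sum; sum-cong-≗; ∑-distrib-+; sum-replicate-zero; sum-permute)

sum-∧-xor : ∀ {n} (x u v : Fin n → Bool) →
            sum (λ b → x b ∧ (u b xor v b)) ≡ sum (λ b → x b ∧ u b) xor sum (λ b → x b ∧ v b)
sum-∧-xor x u v = trans (sum-cong-≗ λ b → Bool.∧-distribˡ-xor (x b) (u b) (v b))
                    (∑-distrib-+ (λ b → x b ∧ u b) (λ b → x b ∧ v b))

sum-∧-δ : ∀ {n} (x : Fin n → Bool) a → sum (λ b → x b ∧ δ a b) ≡ x a
sum-∧-δ {suc n} x zero = trans
  (cong₂ _xor_ (Bool.∧-identityʳ (x zero)) (trans (sum-cong-≗ λ b → Bool.∧-zeroʳ (x (suc b))) (sum-replicate-zero n)))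
  (Bool.xor-identityʳ (x zero))
sum-∧-δ {suc n} x (suc a) = trans
  (cong₂ _xor_ (Bool.∧-zeroʳ (x zero)) (sum-∧-δ (x ∘ suc) a))
  (Bool.xor-identityˡ (x (suc a)))

xor-cancelʳ-≡ : ∀ c {a b} → a xor c ≡ b xor c → a ≡ b
xor-cancelʳ-≡ c {a} {b} eq = begin
  a                ≡⟨ undo a ⟨
  (a xor c) xor c  ≡⟨ cong (_xor c) eq ⟩
  (b xor c) xor c  ≡⟨ undo b ⟩
  b                ∎
  where
  open ≡-Reasoning
  undo : ∀ a → (a xor c) xor c ≡ a
  undo a = trans (Bool.xor-assoc a c c) (trans (cong (a xor_) (Bool.xor-same c)) (Bool.xor-identityʳ a))

-- Together with `arc`, this involution traces the boundary of the spanning ribbon subgraph whose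
-- ribbons are those in `χ`.
attach : ∀ {n} → (Fin n → Bool) → Corner n → Corner n
attach χ y = if χ (edge y) then alongSide y else acrossEnd y

attach-true : ∀ {n} {χ : Fin n → Bool} {y} → χ (edge y) ≡ true → attach χ y ≡ alongSide y
attach-true {y = y} e = cong (if_then alongSide y else acrossEnd y) e

attach-false : ∀ {n} {χ : Fin n → Bool} {y} → χ (edge y) ≡ false → attach χ y ≡ acrossEnd y
attach-false {y = y} e = cong (if_then alongSide y else acrossEnd y) e

-- Measured at the end `false`; by `jump-acrossEnd` an invariant function has the same jump at the
-- other end.
jump : ∀ {n} → (Corner n → Bool) → Fin n → Bool
jump F a = F (a , false , true) xor F (a , false , false)

-- Invariant functions as combinations of potentials

module Combination (B : Bouquet) where

  open Potential B

  private
    G = proj₁ B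
    n = #edges G

  -- This realises a prescribed vector `x` of jumps by a function that is constant along the free
  -- arcs.
  combination : (Fin n → Bool) → Corner n → Bool
  combination x y = sum (λ b → x b ∧ potential b y)

  -- The coordinate (Mx)_a of the matrix product over 𝔽₂.
  row : (Fin n → Bool) → Fin n → Bool
  row x a = sum (λ b → x b ∧ interlacement a b)

  combination-cong : ∀ {x x′} → x ≗ x′ → combination x ≗ combination x′
  combination-cong x≗x′ y = sum-cong-≗ λ b → cong (_∧ potential b y) (x≗x′ b)

  combination-arc : ∀ x → Invariant (arc G) (combination x)
  combination-arc x y = sum-cong-≗ λ b → cong (x b ∧_) (potential-arc b y)

  combination-acrossEnd : ∀ x y → combination x (acrossEnd y) ≡ x (edge y) xor combination x y
  combination-acrossEnd x y = begin
    combination x (acrossEnd y)                                   ≡⟨ sum-cong-≗ (λ b → cong (x b ∧_) (potential-acrossEnd b y)) ⟩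
    sum (λ b → x b ∧ (δ (edge y) b xor potential b y))            ≡⟨ sum-∧-xor x (δ (edge y)) (λ b → potential b y) ⟩
    sum (λ b → x b ∧ δ (edge y) b) xor combination x y            ≡⟨ cong (_xor combination x y) (sum-∧-δ x (edge y)) ⟩
    x (edge y) xor combination x y                                ∎
    where open ≡-Reasoning

  combination-alongSide : ∀ x y → combination x (alongSide y) ≡ row x (edge y) xor combination x y
  combination-alongSide x y = trans
    (sum-cong-≗ λ b → cong (x b ∧_) (potential-alongSide b y))
    (sum-∧-xor x (interlacement (edge y)) (λ b → potential b y))

  module _ {χ : Fin n → Bool} {F : Corner n → Bool}
           (F-arc : Invariant (arc G) F) (F-attach : Invariant (attach χ) F) where

    private
      F-alongSide : ∀ {y} → χ (edge y) ≡ true → F (alongSide y) ≡ F y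
      F-alongSide {y} e = trans (cong F (sym (attach-true {χ = χ} {y} e))) (F-attach y)

      F-acrossEnd : ∀ {y} → χ (edge y) ≡ false → F (acrossEnd y) ≡ F y
      F-acrossEnd {y} e = trans (cong F (sym (attach-false {χ = χ} {y} e))) (F-attach y)

    jump-false : ∀ {a} → χ a ≡ false → jump F a ≡ false
    jump-false {a} e = trans (cong (_xor F (a , false , false)) (F-acrossEnd {a , false , false} e)) (Bool.xor-same (F (a , false , false)))

    -- Off `χ` both the change and the jump vanish. On `χ` the function is constant along sides, so
    -- a crossing at the end `true` can be slid to the end `false`.
    jump-acrossEnd : ∀ y → F (acrossEnd y) ≡ jump F (edge y) xor F y
    jump-acrossEnd y@(a , i , s) with χ a in e
    ... | false = trans (F-acrossEnd {y} e) (cong (_xor F y) (sym (jump-false e)))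
    ... | true  = begin
      F (a , i , not s)                                ≡⟨ slide i (not s) ⟩
      F (a , false , not s)                            ≡⟨ flip s ⟩
      jump F a xor F (a , false , s)                   ≡⟨ cong (jump F a xor_) (slide i s) ⟨
      jump F a xor F (a , i , s)                       ∎
      where
      open ≡-Reasoning
      slide : ∀ i s → F (a , i , s) ≡ F (a , false , s)
      slide false s = refl
      slide true  s = F-alongSide {a , false , s} e
      flip : ∀ s → F (a , false , not s) ≡ jump F a xor F (a , false , s)
      flip false = sym (trans (Bool.xor-assoc (F (a , false , true)) _ _)
        (trans (cong (F (a , false , true) xor_) (Bool.xor-same (F (a , false , false)))) (Bool.xor-identityʳ _)))
      flip true  = sym (trans (cong (_xor F (a , false , true)) (Bool.xor-comm (F (a , false , true)) _))
        (trans (Bool.xor-assoc (F (a , false , false)) _ _)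
          (trans (cong (F (a , false , false) xor_) (Bool.xor-same (F (a , false , true)))) (Bool.xor-identityʳ _))))

    -- `F` and the combination of its jumps change alike across every end and are both constant
    -- along arcs; their difference is therefore constant around the single vertex.
    difference-constant : ∀ y z → F y xor combination (jump F) y ≡ F z xor combination (jump F) z
    difference-constant y z = Orbits.invariant-SameOrbit (arc G) acrossEnd {λ y → F y xor combination (jump F) y}
      (λ y → cong₂ _xor_ (F-arc y) (combination-arc (jump F) y))
      (λ y → trans (cong₂ _xor_ (jump-acrossEnd y) (combination-acrossEnd (jump F) y)) (cancel (jump F (edge y)) (F y) _))
      (bouquet-connected B y z)
      where
      cancel : ∀ a u v → (a xor u) xor (a xor v) ≡ u xor v
      cancel false u v = refl
      cancel true  u v = Bool.xor-annihilates-not u v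

    -- Along a side of a ribbon in `χ` neither `F` nor the constant difference changes, so the
    -- combination does not change either; its change there is (Mx)_a.
    row-false : ∀ {a} → χ a ≡ true → row (jump F) a ≡ false
    row-false {a} e = xor-cancelʳ-≡ (combination (jump F) y) (begin
      row (jump F) a xor combination (jump F) y            ≡⟨ combination-alongSide (jump F) y ⟨
      combination (jump F) (alongSide y)                   ≡⟨ xor-cancelˡ-≡ (F y) (trans
                                                                (cong (_xor combination (jump F) (alongSide y)) (sym (F-alongSide {y} e)))
                                                                (difference-constant (alongSide y) y)) ⟩
      combination (jump F) y                               ∎)
      where
      open ≡-Reasoning
      y : Corner n
      y = a , false , false
      xor-cancelˡ-≡ : ∀ a {b c} → a xor b ≡ a xor c → b ≡ c
      xor-cancelˡ-≡ a {b} {c} eq = trans (sym (xor-cancelˡ a b)) (trans (cong (a xor_) eq) (xor-cancelˡ a c))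

-- Transfer of invariant functions between the bouquets

module Transfer (B₁ B₂ : Bouquet) (iso : SI B₁ ≅ SI B₂) where

  open _≅_ iso
  open Inverse bijection using (to; from; strictlyInverseˡ; strictlyInverseʳ)

  private
    G₁ = proj₁ B₁
    G₂ = proj₁ B₂
    module P₁ = Potential B₁
    module P₂ = Potential B₂
    module C₁ = Combination B₁
    module C₂ = Combination B₂

  interlacement-≡ : ∀ a b → P₁.interlacement a b ≡ P₂.interlacement (to a) (to b)
  interlacement-≡ a b with a Fin.≟ b
  ... | yes refl = Bool.⇔→≡ {z = true} (mk⇔
    (P₂.Twisted⇒interlacement ∘ Equivalence.to (negative a) ∘ P₁.interlacement⇒Twisted)
    (P₁.Twisted⇒interlacement ∘ Equivalence.from (negative a) ∘ P₂.interlacement⇒Twisted))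
  ... | no a≢b = Bool.⇔→≡ {z = true} (mk⇔
    (λ m → P₂.Interlaced⇒interlacement to-≢ (proj₂ (Equivalence.to (adjacent a b) (a≢b , P₁.interlacement⇒Interlaced a≢b m))))
    (λ m → P₁.Interlaced⇒interlacement a≢b (proj₂ (Equivalence.from (adjacent a b) (to-≢ , P₂.interlacement⇒Interlaced to-≢ m)))))
    where
    to-≢ : to a ≢ to b
    to-≢ eq = a≢b (trans (sym (strictlyInverseʳ a)) (trans (cong from eq) (strictlyInverseʳ b)))

  row-≡ : ∀ x a → C₂.row (x ∘ from) a ≡ C₁.row x (from a)
  row-≡ x a = trans (sum-permute (λ b → x (from b) ∧ P₂.interlacement a b) bijection)
    (sum-cong-≗ λ b → cong₂ _∧_ (cong x (strictlyInverseʳ b))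
      (trans (cong (λ a → P₂.interlacement a (to b)) (sym (strictlyInverseˡ a))) (sym (interlacement-≡ (from a) b))))

  module _ {χ₁ : Fin (#edges G₁) → Bool} {χ₂ : Fin (#edges G₂) → Bool} (χ₂≗ : χ₂ ≗ χ₁ ∘ from) where

    private
      module _ (o : Corner (#edges G₁)) where

        -- The jumps of `F` are carried to the second bouquet and reassembled there. They determine
        -- a function only up to a constant, which is recorded by the value at the base corner `o`.
        Φ : (Corner (#edges G₁) → Bool) → Corner (#edges G₂) → Bool
        Φ F y = F o xor C₂.combination (jump F ∘ from) y

        -- On `χ₂` the change along a side is (Mx)_e = 0, a condition that M carries over from the
        -- first bouquet; off `χ₂` the change across an end is a jump, which vanishes.
        Φ-attach : ∀ {F} → Invariant (arc G₁) F → Invariant (attach χ₁) F → Invariant (attach χ₂) (Φ F)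
        Φ-attach {F} F-arc F-attach y with χ₂ (edge y) in e
        ... | true  = cong (F o xor_) (trans (C₂.combination-alongSide (jump F ∘ from) y)
                        (cong (_xor C₂.combination (jump F ∘ from) y)
                          (trans (row-≡ (jump F) (edge y)) (C₁.row-false {χ₁} F-arc F-attach (trans (sym (χ₂≗ (edge y))) e)))))
        ... | false = cong (F o xor_) (trans (C₂.combination-acrossEnd (jump F ∘ from) y)
                        (cong (_xor C₂.combination (jump F ∘ from) y)
                          (C₁.jump-false {χ₁} F-arc F-attach (trans (sym (χ₂≗ (edge y))) e))))

        Φ-acrossEnd : ∀ F y → Φ F (acrossEnd y) ≡ jump F (from (edge y)) xor Φ F y
        Φ-acrossEnd F y = trans (cong (F o xor_) (C₂.combination-acrossEnd (jump F ∘ from) y))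
                            (exchange-xor (F o) (jump F (from (edge y))) _)
          where
          exchange-xor : ∀ a b c → a xor (b xor c) ≡ b xor (a xor c)
          exchange-xor a b c = trans (sym (Bool.xor-assoc a b c)) (trans (cong (_xor c) (Bool.xor-comm a b)) (Bool.xor-assoc b a c))

        -- The changes of `Φ F` across ends give back the jumps of `F`. With equal jumps the
        -- combinations agree, hence so do the values at `o`, and `difference-constant` spreads this
        -- to all corners.
        Φ-injective : ∀ {F H} → Invariant (arc G₁) F → Invariant (attach χ₁) F → Invariant (arc G₁) H → Invariant (attach χ₁) H →
                      Φ F ≗ Φ H → F ≗ H
        Φ-injective {F} {H} F-arc F-attach H-arc H-attach Φ≗ y = xor-cancelʳ-≡ (C₁.combination (jump H) y) (begin
          F y xor C₁.combination (jump H) y     ≡⟨ cong (F y xor_) (C₁.combination-cong jump≗ y) ⟨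
          F y xor C₁.combination (jump F) y     ≡⟨ C₁.difference-constant {χ₁} F-arc F-attach y o ⟩
          F o xor C₁.combination (jump F) o     ≡⟨ cong₂ _xor_ o≡ (C₁.combination-cong jump≗ o) ⟩
          H o xor C₁.combination (jump H) o     ≡⟨ C₁.difference-constant {χ₁} H-arc H-attach o y ⟩
          H y xor C₁.combination (jump H) y     ∎)
          where
          open ≡-Reasoning
          jump≗ : jump F ≗ jump H
          jump≗ a = subst (λ a → jump F a ≡ jump H a) (strictlyInverseʳ a)
            (xor-cancelʳ-≡ (Φ F z) (trans (sym (Φ-acrossEnd F z)) (trans (Φ≗ (acrossEnd z))
              (trans (Φ-acrossEnd H z) (cong (jump H (from (to a)) xor_) (sym (Φ≗ z)))))))
            where
            z : Corner (#edges G₂)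
            z = to a , false , false
          o≡ : F o ≡ H o
          o≡ = xor-cancelʳ-≡ (C₂.combination (jump F ∘ from) z)
            (trans (Φ≗ z) (cong (H o xor_) (sym (C₂.combination-cong (jump≗ ∘ from) z))))
            where
            z : Corner (#edges G₂)
            z = to (edge o) , false , false

    #orbits-attach-≤ : #orbits (arc G₁) (attach χ₁) ≤ #orbits (arc G₂) (attach χ₂)
    -- The base corner for `Φ` comes from arguing by contradiction: if the inequality failed, the
    -- first bouquet would have at least one orbit.
    #orbits-attach-≤ = ℕ.≮⇒≥ λ l<k → let o = Orbits.rep (arc G₁) (attach χ₁) (Fin.fromℕ< (ℕ.≤-<-trans z≤n l<k)) in
      ℕ.<⇒≱ l<k (#orbits-≤ (Φ o)
        (λ {F} F-arc F-attach → (λ y → cong (F o xor_) (C₂.combination-arc (jump F ∘ from) y)) , Φ-attach o F-arc F-attach)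
        (Φ-injective o))

≅-sym : ∀ {S T} → S ≅ T → T ≅ S
≅-sym {S} {T} iso = record
  { bijection = ↔-sym bijection
  ; adjacent  = λ a b → ⇔-sym (subst₂ (λ a′ b′ → S.Adjacent (from a) (from b) ⇔ T.Adjacent a′ b′)
                  (strictlyInverseˡ a) (strictlyInverseˡ b) (adjacent (from a) (from b)))
  ; negative  = λ a → ⇔-sym (subst (λ a′ → S.Negative (from a) ⇔ T.Negative a′) (strictlyInverseˡ a) (negative (from a)))
  }
  where
  open _≅_ iso
  open Inverse bijection using (from; strictlyInverseˡ)
  module S = SignedGraph S
  module T = SignedGraph T

-- Partial duals in terms of orbits

#orbits-conjugate-≤ : ∀ {n} {σ f g f′ g′ : Corner n → Corner n} → Involutive _≡_ σ →
                      f′ ≗ σ ∘ f ∘ σ → g′ ≗ σ ∘ g ∘ σ → #orbits f g ≤ #orbits f′ g′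
#orbits-conjugate-≤ {n} {σ} {f} {g} {f′} {g′} σσ f′≗ g′≗ = #orbits-≤ (_∘ σ)
  (λ Ff Fg → conjugate f′≗ Ff , conjugate g′≗ Fg)
  (λ {F} {H} _ _ _ _ eq x → trans (cong F (sym (σσ x))) (trans (eq (σ x)) (cong H (σσ x))))
  where
  conjugate : ∀ {h h′} → h′ ≗ σ ∘ h ∘ σ → ∀ {F} → Invariant h F → Invariant h′ (F ∘ σ)
  conjugate h′≗ {F} Fh x = trans (cong (F ∘ σ) (h′≗ x)) (trans (cong F (σσ _)) (Fh (σ x)))

module _ {n} (A : Subset n) where

  private σ = exchange A

  -- Exchanging the coordinates swaps ends and sides of the ribbons in `A`. Thus χ = A for the
  -- vertices of the partial dual, and, in the next lemma, χ is the complement of A for its boundary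
  -- components.
  exchange-acrossEnd : σ ∘ acrossEnd ∘ σ ≗ attach (Vec.lookup A)
  exchange-acrossEnd (e , i , s) with Vec.lookup A e in eq
  ... | true  rewrite eq = refl
  ... | false rewrite eq = refl

  exchange-alongSide : σ ∘ alongSide ∘ σ ≗ attach (not ∘ Vec.lookup A)
  exchange-alongSide (e , i , s) with Vec.lookup A e in eq
  ... | true  rewrite eq = refl
  ... | false rewrite eq = refl

  -- Conjugating both involutions by σ preserves the number of orbits; this frees the arcs of the
  -- partial dual from σ at the cost of conjugating `g`.
  #orbits-exchange : ∀ f {g h} → σ ∘ g ∘ σ ≗ h → #orbits (σ ∘ f ∘ σ) g ≡ #orbits f h
  #orbits-exchange f {g} {h} eq = ℕ.≤-antisym
    (#orbits-conjugate-≤ {σ = σ} σσ (λ x → sym (trans (σσ _) (cong f (σσ x)))) (sym ∘ eq))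
    (#orbits-conjugate-≤ {σ = σ} σσ (λ _ → refl) (λ x → sym (trans (cong σ (sym (eq (σ x)))) (trans (σσ _) (cong g (σσ x))))))
    where σσ = exchange-involutive A

-- Comparison of the coefficients

image : ∀ {m n} → Fin m ↔ Fin n → Subset m → Subset n
image π A = Vec.tabulate (Vec.lookup A ∘ Inverse.from π)

image-injective : ∀ {m n} (π : Fin m ↔ Fin n) {A A′} → image π A ≡ image π A′ → A ≡ A′
image-injective π {A} {A′} eq = begin
  A                              ≡⟨ Vec.tabulate∘lookup A ⟨
  Vec.tabulate (Vec.lookup A)    ≡⟨ Vec.tabulate-cong (λ a → trans (sym (lookup-to A a)) (trans (cong (λ C → Vec.lookup C (to a)) eq) (lookup-to A′ a))) ⟩
  Vec.tabulate (Vec.lookup A′)   ≡⟨ Vec.tabulate∘lookup A′ ⟩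
  A′                             ∎
  where
  open ≡-Reasoning
  open Inverse π using (to; strictlyInverseʳ)
  lookup-to : ∀ A a → Vec.lookup (image π A) (to a) ≡ Vec.lookup A a
  lookup-to A a = trans (Vec.lookup∘tabulate _ (to a)) (cong (Vec.lookup A) (strictlyInverseʳ a))

∈-subsets : ∀ {n} (A : Subset n) → A ∈ subsets n
∈-subsets Vec.[]              = here refl
∈-subsets (outside Vec.∷ A) = ∈-++⁺ˡ (∈-map⁺ _ (∈-subsets A))
∈-subsets (inside  Vec.∷ A) = ∈-++⁺ʳ (map (outside Vec.∷_) (subsets _)) (∈-map⁺ _ (∈-subsets A))

subsets-! : ∀ n → Propositional.Unique (subsets n)
subsets-! zero    = [] ∷ []
subsets-! (suc n) = Unique.++⁺ (Unique.map⁺ Vec.∷-injectiveʳ (subsets-! n)) (Unique.map⁺ Vec.∷-injectiveʳ (subsets-! n)) disjoint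
  where
  disjoint : ∀ {A} → A ∈ map (outside Vec.∷_) (subsets n) × A ∈ map (inside Vec.∷_) (subsets n) → _
  disjoint (p , q) with ∈-map⁻ _ p | ∈-map⁻ _ q
  ... | _ , _ , refl | _ , _ , ()

-- Each index of `xs` is sent to the position of the image in `ys`; as `xs` has no repetitions and
-- `h` is injective, this map of indices is injective.
length-≤ : ∀ {A B : Set} {xs : List A} {ys : List B} (h : A → B) → (∀ {x y} → h x ≡ h y → x ≡ y) →
           Propositional.Unique xs → (∀ {x} → x ∈ xs → h x ∈ ys) → length xs ≤ length ys
length-≤ {A} {B} {xs} {ys} h h-injective xs! h∈ = Fin.injective⇒≤
  {f = λ i → Any.index (h∈ (∈-lookup i))}
  λ {i} {j} eq → lookup-injective (setoid A) xs! (h-injective (index-injective (setoid B) (h∈ (∈-lookup i)) (h∈ (∈-lookup j)) eq))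

module _ (B₁ B₂ : Bouquet) (iso : SI B₁ ≅ SI B₂) where

  open _≅_ iso using (bijection)
  open Inverse bijection using (to; from; strictlyInverseˡ; strictlyInverseʳ)

  private
    G₁ = proj₁ B₁
    G₂ = proj₁ B₂

  #edges-≡ : #edges G₁ ≡ #edges G₂
  #edges-≡ = ↔⇒≡ bijection

  #isolated-≡ : #isolated G₁ ≡ #isolated G₂
  #isolated-≡ = trans (bouquet-#isolated B₁) (trans (cong (1 ∸_) #edges-≡) (sym (bouquet-#isolated B₂)))

  #orbits-attach-≡ : ∀ {χ₁ χ₂} → χ₂ ≗ χ₁ ∘ from → #orbits (arc G₁) (attach χ₁) ≡ #orbits (arc G₂) (attach χ₂)
  #orbits-attach-≡ {χ₁} χ₂≗ = ℕ.≤-antisym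
    (Transfer.#orbits-attach-≤ B₁ B₂ iso χ₂≗)
    (Transfer.#orbits-attach-≤ B₂ B₁ (≅-sym iso) (λ a → trans (cong χ₁ (sym (strictlyInverseʳ a))) (sym (χ₂≗ (to a)))))

  module _ (A : Subset (#edges G₁)) where

    private
      A′ = image bijection A

      lookup-A′ : Vec.lookup A′ ≗ Vec.lookup A ∘ from
      lookup-A′ = Vec.lookup∘tabulate (Vec.lookup A ∘ from)

    #vertices-partialDual : #vertices (partialDual G₁ A) ≡ #vertices (partialDual G₂ A′)
    #vertices-partialDual = cong₂ _+_ #isolated-≡ (trans (#orbits-exchange A (arc G₁) (exchange-acrossEnd A))
      (trans (#orbits-attach-≡ lookup-A′) (sym (#orbits-exchange A′ (arc G₂) (exchange-acrossEnd A′)))))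

    #boundaries-partialDual : #boundaries (partialDual G₁ A) ≡ #boundaries (partialDual G₂ A′)
    #boundaries-partialDual = cong₂ _+_ #isolated-≡ (trans (#orbits-exchange A (arc G₁) (exchange-alongSide A))
      (trans (#orbits-attach-≡ (cong not ∘ lookup-A′)) (sym (#orbits-exchange A′ (arc G₂) (exchange-alongSide A′)))))

    eulerGenus-partialDual : eulerGenus (partialDual G₁ A) ≡ eulerGenus (partialDual G₂ A′)
    eulerGenus-partialDual = cong (ℤ._-_ (+ 2)) (cong₂ ℤ._+_
      (cong₂ (λ v e → + v ℤ.- + e) #vertices-partialDual #edges-≡) (cong +_ #boundaries-partialDual))

  -- Taking images under the isomorphism maps edge sets injectively and keeps the Euler genus of the
  -- partial dual, so the sets counted on the left embed into those counted on the right.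
  ∂ε-≤ : ∀ k → ∂ε G₁ k ≤ ∂ε G₂ k
  ∂ε-≤ k = length-≤ (image bijection) (image-injective bijection)
    (Unique.filter⁺ (has-genus G₁) (subsets-! (#edges G₁)))
    (λ {A} A∈ → ∈-filter⁺ (has-genus G₂) (∈-subsets (image bijection A))
      (trans (sym (eulerGenus-partialDual A)) (proj₂ (∈-filter⁻ (has-genus G₁) {xs = subsets (#edges G₁)} A∈))))
    where has-genus = λ G A → eulerGenus (partialDual G A) ℤ.≟ k

theorem9 : (B₁ B₂ : Bouquet) → SI B₁ ≅ SI B₂ → ∂ε (proj₁ B₁) ≗ ∂ε (proj₁ B₂)
theorem9 B₁ B₂ iso k = ℕ.≤-antisym (∂ε-≤ B₁ B₂ iso k) (∂ε-≤ B₂ B₁ (≅-sym iso) k)
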